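{- For every positive integer $n$, the pegging number of the hypercube $Q_n$ is $P(Q_n) = 2^{n-1}+1$.
   Context: $Q_n$ is the Cartesian product of $n$ copies of $K_2$, i.e. the graph on binary $n$-tuples with two tuples adjacent iff they differ in exactly one coordinate. A distribution of pegs on a graph $\Gamma$ is a subset $D \subseteq V(\Gamma)$. If $u,v \in D$ are distinct adjacent vertices and $w \notin D$ is a vertex adjacent to $v$, the pegging move (jumping $u$ over $v$ into $w$) replaces $D$ by $(D\setminus\{u,v\})\cup\{w\}$. A vertex $t$ is reachable from $D$ if some finite (possibly empty) sequence of pegging moves starting from $D$ ends in a distribution containing $t$; $\mathrm{Reach}(D)$ is the set of reachable vertices. The pegging number $P(\Gamma)$ is the smallest positive integer $d$ such that every distribution of size $d$ on $\Gamma$ has reach $V(\Gamma)$. -}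

module Defs where

open import Data.Nat using (ℕ; zero; suc; _+_; _^_; _≤_; _<_; _∸_)
open import Data.Bool using (Bool; true; false; if_then_else_; _∨_)
open import Data.Vec using (Vec; []; _∷_)
open import Data.Vec.Properties using (≡-dec)
open import Data.Bool.Properties using () renaming (_≟_ to _≟B_)
open import Data.List using (List; []; _∷_; map; _++_; length; filter)
open import Data.Product using (Σ; _×_; ∃; ∃-syntax)
open import Relation.Nullary using (¬_; Dec; yes; no; does)
open import Relation.Binary.PropositionalEquality using (_≡_; _≢_)
open import Relation.Binary.Construct.Closure.ReflexiveTransitive using (Star)

Vertex : ℕ → Set
Vertex n = Vec Bool n

_≟V_ : ∀ {n} → (x y : Vertex n) → Dec (x ≡ y)
_≟V_ = ≡-dec _≟B_

hamming : ∀ {n} → Vertex n → Vertex n → ℕ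
hamming [] [] = 0
hamming (a ∷ x) (b ∷ y) = (if does (a ≟B b) then 0 else 1) + hamming x y

Adj : ∀ {n} → Vertex n → Vertex n → Set
Adj x y = hamming x y ≡ 1

allVertices : (n : ℕ) → List (Vertex n)
allVertices zero = [] ∷ []
allVertices (suc n) = map (false ∷_) (allVertices n) ++ map (true ∷_) (allVertices n)

-- A distribution of pegs: a (decidable) subset of V(Q_n), given by its indicator.
Distribution : ℕ → Set
Distribution n = Vertex n → Bool

size : ∀ {n} → Distribution n → ℕ
size {n} D = length (filter (λ x → D x ≟B true) (allVertices n))

jump : ∀ {n} → Distribution n → Vertex n → Vertex n → Vertex n → Distribution n
jump D u v w x =
  if does (x ≟V w) then true
  else (if does (x ≟V u) ∨ does (x ≟V v) then false else D x)

data Move {n : ℕ} (D : Distribution n) : Distribution n → Set where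
  peg : (u v w : Vertex n) →
        D u ≡ true → D v ≡ true → u ≢ v → Adj u v →
        D w ≡ false → Adj v w →
        Move D (jump D u v w)

Reachable : ∀ {n} → Distribution n → Vertex n → Set
Reachable {n} D t = ∃[ D' ] (Star (Move {n}) D D' × D' t ≡ true)

FullReach : ∀ {n} → Distribution n → Set
FullReach {n} D = (t : Vertex n) → Reachable D t

AllFullReach : ℕ → ℕ → Set
AllFullReach n d = (D : Distribution n) → size D ≡ d → FullReach D

IsPeggingNumber : ℕ → ℕ → Set
IsPeggingNumber n d =
  1 ≤ d × AllFullReach n d × ((d' : ℕ) → 1 ≤ d' → d' < d → ¬ AllFullReach n d')

{-# OPTIONS --safe #-}
module Submission where

-- Call the edges in one fixed direction cells; they form a Q_(n-1), and a distribution puts at most two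
-- pegs on each. If p is a full cell and the neighbouring cell q is not, then jumping one peg of p over the
-- other removes both and fills a hole of q, which is a pebbling move from p to q. By Chung's theorem
-- 2 ^ (n - 1) pebbles suffice to move one to any vertex of Q_(n-1), and the moves of such a solution can be
-- ordered so that no cell ever has to hold more than two pegs. The one additional peg allows for the cell
-- of the target vertex, whose other vertex may already be occupied.
-- Conversely, no move is possible from a distribution of even vertices.

open import Defs
open import Data.Nat using (ℕ; zero; suc; _+_; _*_; _^_; _≤_; _<_; _∸_; z≤n; s≤s; s≤s⁻¹; _≤?_; _<?_; _/_; _%_)
open import Data.Nat.Properties
open import Data.Nat.DivMod using (m≡m%n+[m/n]*n; m%n<n)
open import Data.Nat.Tactic.RingSolver using (solve-∀)
open import Data.Bool using (Bool; true; false; not; _xor_; if_then_else_)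
open import Data.Bool.Properties using (not-involutive) renaming (_≟_ to _≟B_)
open import Data.Empty using (⊥-elim)
open import Data.List using ([]; _∷_; length; filter; map; _++_)
open import Data.List.Properties using (length-++; filter-++)
open import Data.Product using (Σ; _×_; _,_; ∃; proj₁; proj₂)
open import Data.Vec using ([]; _∷_; replicate; zipWith)
open import Data.Vec.Properties using (∷-injectiveʳ; ∷-injectiveˡ)
open import Relation.Binary.Construct.Closure.ReflexiveTransitive using (ε; _◅_)
open import Relation.Binary.PropositionalEquality
open import Relation.Nullary using (¬_; Dec; yes; no; does)

private variable
  m n : ℕ

-- Sums over the vertices of a cube.

total : (Vertex m → ℕ) → ℕ
total {zero}  f = f []
total {suc m} f = total (λ x → f (false ∷ x)) + total (λ x → f (true ∷ x))

total-cong : {f g : Vertex m → ℕ} → (∀ x → f x ≡ g x) → total f ≡ total g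
total-cong {zero}  eq = eq []
total-cong {suc m} eq =
  cong₂ _+_ (total-cong (λ x → eq (false ∷ x))) (total-cong (λ x → eq (true ∷ x)))

total-mono : {f g : Vertex m → ℕ} → (∀ x → f x ≤ g x) → total f ≤ total g
total-mono {zero}  le = le []
total-mono {suc m} le =
  +-mono-≤ (total-mono (λ x → le (false ∷ x))) (total-mono (λ x → le (true ∷ x)))

+-interchange : ∀ a b c d → (a + b) + (c + d) ≡ (a + c) + (b + d)
+-interchange = solve-∀

total-+ : (f g : Vertex m → ℕ) → total (λ x → f x + g x) ≡ total f + total g
total-+ {zero}  f g = refl
total-+ {suc m} f g =
  trans (cong₂ _+_ (total-+ (λ x → f (false ∷ x)) (λ x → g (false ∷ x)))
                   (total-+ (λ x → f (true ∷ x)) (λ x → g (true ∷ x))))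
        (+-interchange (total (λ x → f (false ∷ x))) _ _ _)

total-const : ∀ m k → total {m} (λ _ → k) ≡ 2 ^ m * k
total-const zero    k = sym (+-identityʳ k)
total-const (suc m) k = trans (cong₂ _+_ (total-const m k) (total-const m k)) (double (2 ^ m) k)
  where
  double : ∀ a k → a * k + a * k ≡ 2 * a * k
  double = solve-∀

total-0 : ∀ m → total {m} (λ _ → 0) ≡ 0
total-0 m = trans (total-const m 0) (*-zeroʳ (2 ^ m))

-- A greedy choice: the `false` half is exhausted before anything is taken from the `true` half. It
-- selects the pairs to be spent in `supplies-2` and the even vertices in `not-full-reach`.
total-split : (f : Vertex m → ℕ) (t : ℕ) → t ≤ total f →
              ∃ λ y → (∀ x → y x ≤ f x) × total y ≡ t
total-split {zero} f t t≤ = (λ _ → t) , (λ { [] → t≤ }) , refl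
total-split {suc m} f t t≤ with t ≤? total (λ x → f (false ∷ x))
... | yes t≤₀ with total-split _ t t≤₀
...   | y , y≤ , eq =
      (λ { (false ∷ x) → y x ; (true ∷ x) → 0 })
    , (λ { (false ∷ x) → y≤ x ; (true ∷ x) → z≤n })
    , trans (cong₂ _+_ eq (total-0 m)) (+-identityʳ t)
total-split {suc m} f t t≤ | no t≰₀ with total-split (λ x → f (true ∷ x)) (t ∸ total (λ x → f (false ∷ x)))
                                           (m≤n+o⇒m∸n≤o t _ t≤)
...   | y , y≤ , eq =
      (λ { (false ∷ x) → f (false ∷ x) ; (true ∷ x) → y x })
    , (λ { (false ∷ x) → ≤-refl ; (true ∷ x) → y≤ x })
    , trans (cong (total (λ x → f (false ∷ x)) +_) eq) (m+[n∸m]≡n (<⇒≤ (≰⇒> t≰₀)))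

-- Defined by recursion on the coordinates, so that `δ origin` reduces on each half of a cube.
δ : Vertex m → Vertex m → ℕ
δ []      []      = 1
δ (a ∷ p) (b ∷ x) = if does (a ≟B b) then δ p x else 0

δ-refl : (p : Vertex m) → δ p p ≡ 1
δ-refl []          = refl
δ-refl (false ∷ p) = δ-refl p
δ-refl (true ∷ p)  = δ-refl p

δ-≢ : (p x : Vertex m) → p ≢ x → δ p x ≡ 0
δ-≢ []          []          p≢x = ⊥-elim (p≢x refl)
δ-≢ (false ∷ p) (false ∷ x) p≢x = δ-≢ p x (λ e → p≢x (cong (false ∷_) e))
δ-≢ (false ∷ p) (true ∷ x)  p≢x = refl
δ-≢ (true ∷ p)  (false ∷ x) p≢x = refl
δ-≢ (true ∷ p)  (true ∷ x)  p≢x = δ-≢ p x (λ e → p≢x (cong (true ∷_) e))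

total-δ : (p : Vertex m) → total (δ p) ≡ 1
total-δ [] = refl
total-δ {suc m} (false ∷ p) = cong₂ _+_ (total-δ p) (total-0 m)
total-δ {suc m} (true ∷ p)  = cong₂ _+_ (total-0 m) (total-δ p)

-- Pebbling plans and Chung's theorem.

origin : Vertex m
origin = replicate _ false

weight : Vertex m → ℕ
weight []          = 0
weight (false ∷ x) = weight x
weight (true ∷ x)  = suc (weight x)

weight-origin : ∀ m → weight (origin {m}) ≡ 0
weight-origin zero    = refl
weight-origin (suc m) = weight-origin m

weight≤ : (x : Vertex m) → weight x ≤ m
weight≤ []          = z≤n
weight≤ (false ∷ x) = m≤n⇒m≤1+n (weight≤ x)
weight≤ (true ∷ x)  = s≤s (weight≤ x)

-- A multiset of pebbling moves (two pebbles leave a vertex, one arrives at a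
-- neighbour), all directed towards the origin: y x counts the moves from true ∷ x to false ∷ x.
data Plan : ℕ → Set where
  leaf : Plan 0
  node : (N F : Plan m) (y : Vertex m → ℕ) → Plan (suc m)

out : Plan m → Vertex m → ℕ
out leaf         _           = 0
out (node N F y) (false ∷ x) = out N x
out (node N F y) (true ∷ x)  = y x + out F x

inn : Plan m → Vertex m → ℕ
inn leaf         _           = 0
inn (node N F y) (false ∷ x) = y x + inn N x
inn (node N F y) (true ∷ x)  = inn F x

moves : Plan m → ℕ
moves leaf         = 0
moves (node N F y) = moves N + moves F + total y

noMoves : ∀ m → Plan m
noMoves zero    = leaf
noMoves (suc m) = node (noMoves m) (noMoves m) (λ _ → 0)

out-noMoves : (x : Vertex m) → out (noMoves m) x ≡ 0
out-noMoves []          = refl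
out-noMoves (false ∷ x) = out-noMoves x
out-noMoves (true ∷ x)  = out-noMoves x

-- Only the balance of a plan matters; that it can be carried out in some order is a
-- separate matter (reach-by-plan).
Supplies : ℕ → (Vertex m → ℕ) → Set
Supplies {m} k c = Σ (Plan m) λ P → ∀ x → out P x + out P x + k * δ origin x ≤ c x + inn P x

supplies-0 : (c : Vertex m → ℕ) → Supplies 0 c
supplies-0 {m} c = noMoves m , λ x →
  subst (λ o → o + o + 0 ≤ c x + inn (noMoves m) x) (sym (out-noMoves x)) z≤n

-- The far half (`true`) spends `y x + y x` pebbles on sending `y x` across and retains `d x`. The
-- `2 * j` pebbles that `d` supplies at the far origin pay for `j` more crossings there, hence the
-- term `j * δ origin x` in the node.
supplies-node : (c : Vertex (suc m) → ℕ) (y d : Vertex m → ℕ) (i j : ℕ) →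
  (∀ x → d x + (y x + y x) ≤ c (true ∷ x)) →
  Supplies i (λ x → c (false ∷ x) + y x) → Supplies (2 * j) d → Supplies (i + j) c
supplies-node c y d i j d≤ (N , balN) (F , balF) =
  node N F (λ x → y x + j * δ origin x) , bal
  where
  eq₁ : ∀ o i j e → (o + i * e) + j * e ≡ o + (i + j) * e
  eq₁ = solve-∀
  eq₂ : ∀ c y n j e → (c + y + n) + j * e ≡ c + (y + j * e + n)
  eq₂ = solve-∀
  eq₃ : ∀ o j e y k → (o + o + 2 * j * e) + (y + y) ≡ (y + j * e + o) + (y + j * e + o) + k * 0
  eq₃ = solve-∀
  eq₄ : ∀ d n y → (d + n) + (y + y) ≡ (d + (y + y)) + n
  eq₄ = solve-∀
  bal : ∀ x → _
  bal (false ∷ x) =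
    subst₂ _≤_ (eq₁ (out N x + out N x) i j (δ origin x))
               (eq₂ (c (false ∷ x)) (y x) (inn N x) j (δ origin x))
               (+-monoˡ-≤ (j * δ origin x) (balN x))
  bal (true ∷ x) =
    subst (_≤ c (true ∷ x) + inn F x) (eq₃ (out F x) j (δ origin x) (y x) (i + j))
      (≤-trans (+-monoˡ-≤ (y x + y x) (balF x))
        (≤-trans (≤-reflexive (eq₄ (d x) (inn F x) (y x))) (+-monoˡ-≤ (inn F x) (d≤ x))))

supplies-mono : {k : ℕ} {c c′ : Vertex m → ℕ} → (∀ x → c x ≤ c′ x) → Supplies k c → Supplies k c′
supplies-mono c≤ (P , bal) = P , λ x → ≤-trans (bal x) (+-monoˡ-≤ (inn P x) (c≤ x))

n≡n%2+n/2+n/2 : ∀ n → n ≡ n % 2 + (n / 2 + n / 2)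
n≡n%2+n/2+n/2 n = trans (m≡m%n+[m/n]*n n 2) (cong (n % 2 +_) (*2 (n / 2)))
  where
  *2 : ∀ k → k * 2 ≡ k + k
  *2 = solve-∀

total-o+2h : (o h : Vertex m → ℕ) →
             total (λ x → o x + (h x + h x)) ≡ total o + (total h + total h)
total-o+2h o h = trans (total-+ o _) (cong (total o +_) (total-+ h h))

total-bits : (o : Vertex m → ℕ) → (∀ x → o x ≤ 1) → total o ≤ 2 ^ m
total-bits {m} o o≤1 =
  ≤-trans (total-mono o≤1) (≤-reflexive (trans (total-const m 1) (*-identityʳ (2 ^ m))))

-- Chung's induction: 2 ^ m pebbles supply one pebble at the origin, and two pebbles are supplied
-- as soon as the number of pebbles plus the number of odd piles exceeds 2 ^ (m + 1). With o the parity
-- of a pile and h half of its rest, the latter condition reads total o + total h > 2 ^ m.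
supplies-1 : ∀ m (c : Vertex m → ℕ) → 2 ^ m ≤ total c → Supplies 1 c
supplies-2 : ∀ m (o h : Vertex m → ℕ) → (∀ x → o x ≤ 1) → 2 ^ m < total o + total h →
             Supplies 2 (λ x → o x + (h x + h x))

supplies-1 zero c le = leaf , λ { [] → ≤-trans le (m≤m+n _ 0) }
supplies-1 (suc m) c le
  with 2 ^ m <? total (λ x → c (true ∷ x) % 2) + total (λ x → c (true ∷ x) / 2)
-- The far half alone brings two pebbles to its own origin, and these pay for one crossing.
... | yes many = supplies-node c (λ _ → 0) _ 0 1
      (λ x → ≤-reflexive (trans (+-identityʳ _) (sym (n≡n%2+n/2+n/2 (c (true ∷ x))))))
      (supplies-0 _)
      (supplies-2 m _ _ (λ x → s≤s⁻¹ (m%n<n (c (true ∷ x)) 2)) many)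
-- All pairs of the far half are sent across. This loses `total o + total h` pebbles, the odd ones
-- left behind and the cost of the crossings. That is at most `2 ^ m`, so the near half ends up with
-- at least `2 ^ m`.
... | no few = supplies-node c h o 1 0
      (λ x → ≤-reflexive (sym (n≡n%2+n/2+n/2 (c (true ∷ x)))))
      (supplies-1 m _ (subst (2 ^ m ≤_) (sym (total-+ (λ x → c (false ∷ x)) h)) near≥))
      (supplies-0 _)
  where
  o h : Vertex m → ℕ
  o x = c (true ∷ x) % 2
  h x = c (true ∷ x) / 2
  tN : ℕ
  tN = total (λ x → c (false ∷ x))
  far : total (λ x → c (true ∷ x)) ≡ total o + (total h + total h)
  far = trans (total-cong (λ x → n≡n%2+n/2+n/2 (c (true ∷ x)))) (total-o+2h o h)
  regroup : ∀ a b c → a + (b + (c + c)) ≡ a + c + (b + c)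
  regroup = solve-∀
  near≥ : 2 ^ m ≤ tN + total h
  near≥ = +-cancelʳ-≤ (2 ^ m) _ _ (begin
    2 ^ m + 2 ^ m                              ≡⟨ cong (2 ^ m +_) (sym (+-identityʳ (2 ^ m))) ⟩
    2 ^ suc m                                  ≤⟨ le ⟩
    tN + total (λ x → c (true ∷ x))            ≡⟨ cong (tN +_) far ⟩
    tN + (total o + (total h + total h))       ≡⟨ regroup tN (total o) (total h) ⟩
    tN + total h + (total o + total h)         ≤⟨ +-monoʳ-≤ (tN + total h) (≮⇒≥ few) ⟩
    tN + total h + 2 ^ m                       ∎)
    where open ≤-Reasoning

supplies-2 zero o h o≤1 lt = leaf , λ { [] → ≤-trans 2≤ (m≤m+n _ 0) }
  where
  1≤h : 1 ≤ h []
  1≤h = +-cancelˡ-≤ 1 _ _ (≤-trans lt (+-monoˡ-≤ (h []) (o≤1 [])))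
  2≤ : 2 ≤ o [] + (h [] + h [])
  2≤ = ≤-trans lt (+-monoʳ-≤ (o []) (m≤m+n (h []) (h [])))
supplies-2 (suc m) o h o≤1 lt
  with 2 ^ m <? total (λ x → o (false ∷ x)) + total (λ x → h (false ∷ x))
-- The near half meets the condition by itself, so nothing crosses.
... | yes many = supplies-node _ (λ _ → 0) _ 2 0 (λ x → ≤-reflexive (+-identityʳ _))
      (supplies-mono {k = 2} (λ x → m≤m+n _ 0) (supplies-2 m _ _ (λ x → o≤1 (false ∷ x)) many))
      (supplies-0 _)
-- One pebble comes from the near half, topped up to `2 ^ m` by `t` pebbles from the far half (none
-- if it has enough). The other crosses from the far origin, paid for by two pebbles supplied from
-- what the far half retains.
... | no few = supplies-node _ y _ 1 1 far≤
      (supplies-1 m _ (subst (2 ^ m ≤_) (sym (trans (total-+ cN y) (cong (total cN +_) ty)))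
                             (m≤n+m∸n (2 ^ m) (total cN))))
      (supplies-2 m oF (λ x → hF x ∸ y x) (λ x → o≤1 (true ∷ x)) rest)
  where
  open ≤-Reasoning
  oN hN oF hF cN : Vertex m → ℕ
  oN x = o (false ∷ x)
  hN x = h (false ∷ x)
  oF x = o (true ∷ x)
  hF x = h (true ∷ x)
  cN x = oN x + (hN x + hN x)
  t : ℕ
  t = 2 ^ m ∸ total cN
  t+near≤ : t + (total oN + total hN) ≤ 2 ^ m
  t+near≤ with total cN ≤? 2 ^ m
  ... | yes cN≤ = begin
        t + (total oN + total hN)
          ≤⟨ +-monoʳ-≤ t (+-monoʳ-≤ (total oN) (m≤m+n (total hN) (total hN))) ⟩
        t + (total oN + (total hN + total hN)) ≡⟨ cong (t +_) (sym (total-o+2h oN hN)) ⟩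
        t + total cN                           ≡⟨ m∸n+n≡m cN≤ ⟩
        2 ^ m                                  ∎
  ... | no cN≰ = begin
        t + (total oN + total hN)  ≡⟨ cong (_+ (total oN + total hN)) (m≤n⇒m∸n≡0 (<⇒≤ (≰⇒> cN≰))) ⟩
        total oN + total hN        ≤⟨ ≮⇒≥ few ⟩
        2 ^ m                      ∎
  regroup : ∀ t a b c d → t + (a + b + (c + d)) ≡ (t + (a + c)) + (b + d)
  regroup = solve-∀
  -- Since `t` and the near share together are at most `2 ^ m`, the far share exceeds `2 ^ m + t`.
  -- As the parities sum to at most `2 ^ m`, there are `t` pairs to give away; doing so keeps the
  -- parities and lowers the far share by exactly `t`.
  far> : 2 ^ m + t < total oF + total hF
  far> = +-cancelˡ-< (2 ^ m) _ _ (begin-strict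
    2 ^ m + (2 ^ m + t)                ≡⟨ shuffle (2 ^ m) t ⟩
    t + 2 ^ suc m                      <⟨ +-monoʳ-< t lt ⟩
    t + (total oN + total oF + (total hN + total hF))
                                       ≡⟨ regroup t (total oN) (total oF) (total hN) (total hF) ⟩
    (t + (total oN + total hN)) + (total oF + total hF)
                                       ≤⟨ +-monoˡ-≤ (total oF + total hF) t+near≤ ⟩
    2 ^ m + (total oF + total hF)      ∎)
    where
    shuffle : ∀ a t → a + (a + t) ≡ t + 2 * a
    shuffle = solve-∀
  t≤ : t ≤ total hF
  t≤ = +-cancelˡ-≤ (2 ^ m) _ _
         (≤-trans (<⇒≤ far>) (+-monoˡ-≤ (total hF) (total-bits oF (λ x → o≤1 (true ∷ x)))))
  split : ∃ λ y → (∀ x → y x ≤ hF x) × total y ≡ t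
  split = total-split hF t t≤
  y : Vertex m → ℕ
  y = proj₁ split
  y≤ : ∀ x → y x ≤ hF x
  y≤ = proj₁ (proj₂ split)
  ty : total y ≡ t
  ty = proj₂ (proj₂ split)
  hF≡ : total hF ≡ total (λ x → hF x ∸ y x) + t
  hF≡ = trans (total-cong (λ x → sym (m∸n+n≡m (y≤ x))))
              (trans (total-+ (λ x → hF x ∸ y x) y) (cong (total (λ x → hF x ∸ y x) +_) ty))
  rest : 2 ^ m < total oF + total (λ x → hF x ∸ y x)
  rest = +-cancelʳ-< t _ _ (subst (2 ^ m + t <_)
           (trans (cong (total oF +_) hF≡) (sym (+-assoc (total oF) _ t))) far>)
  far≤ : ∀ x → oF x + ((hF x ∸ y x) + (hF x ∸ y x)) + (y x + y x) ≤ oF x + (hF x + hF x)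
  far≤ x = ≤-reflexive (trans (pair (oF x) (hF x ∸ y x) (y x))
             (cong (λ k → oF x + (k + k)) (m∸n+n≡m (y≤ x))))
    where
    pair : ∀ o r y → o + (r + r) + (y + y) ≡ o + ((r + y) + (r + y))
    pair = solve-∀

-- Taking single moves out of a plan.

-- By `heavier`, passing from a cell to one that feeds it leads away from the origin, which bounds
-- the search in `climb`; `fewer` is the measure for carrying out a plan.
record MoveInto (P : Plan m) (q : Vertex m) : Set where
  field
    from    : Vertex m
    others  : Plan m
    adj     : Adj from q
    heavier : weight from ≡ suc (weight q)
    out≡    : ∀ x → out P x ≡ δ from x + out others x
    inn≡    : ∀ x → inn P x ≡ δ q x + inn others x
    fewer   : moves P ≡ suc (moves others)

hamming-refl : (x : Vertex m) → hamming x x ≡ 0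
hamming-refl []          = refl
hamming-refl (false ∷ x) = hamming-refl x
hamming-refl (true ∷ x)  = hamming-refl x

-- Moves into `true ∷ q` all lie in `F`. A move into `false ∷ q` is taken across the first direction
-- if `y q` is positive, and from `N` otherwise.
moveInto : (P : Plan m) (q : Vertex m) → 1 ≤ inn P q → MoveInto P q
moveInto (node N F y) (true ∷ q) 1≤ = record
  { from    = true ∷ from
  ; others  = node N others y
  ; adj     = adj
  ; heavier = cong suc heavier
  ; out≡    = λ { (false ∷ x) → refl
                ; (true ∷ x)  → trans (cong (y x +_) (out≡ x)) (swap (y x) (δ from x) (out others x)) }
  ; inn≡    = λ { (false ∷ x) → refl ; (true ∷ x) → inn≡ x }
  ; fewer   = trans (cong (λ k → moves N + k + total y) fewer)
                    (cong (_+ total y) (+-suc (moves N) (moves others)))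
  }
  where
  open MoveInto (moveInto F q 1≤)
  swap : ∀ a b c → a + (b + c) ≡ b + (a + c)
  swap = solve-∀
moveInto (node N F y) (false ∷ q) 1≤ with y q in yq
... | zero = record
  { from    = false ∷ from
  ; others  = node others F y
  ; adj     = adj
  ; heavier = heavier
  ; out≡    = λ { (false ∷ x) → out≡ x ; (true ∷ x) → refl }
  ; inn≡    = λ { (false ∷ x) → trans (cong (y x +_) (inn≡ x)) (swap (y x) (δ q x) (inn others x))
                ; (true ∷ x)  → refl }
  ; fewer   = cong (λ k → k + moves F + total y) fewer
  }
  where
  open MoveInto (moveInto N q 1≤)
  swap : ∀ a b c → a + (b + c) ≡ b + (a + c)
  swap = solve-∀
... | suc k = record
  { from    = true ∷ q
  ; others  = node N F y′
  ; adj     = cong suc (hamming-refl q)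
  ; heavier = refl
  ; out≡    = λ { (false ∷ x) → refl
                ; (true ∷ x)  → trans (cong (_+ out F x) (y≡ x)) (+-assoc (δ q x) (y′ x) (out F x)) }
  ; inn≡    = λ { (false ∷ x) → trans (cong (_+ inn N x) (y≡ x)) (+-assoc (δ q x) (y′ x) (inn N x))
                ; (true ∷ x)  → refl }
  ; fewer   = trans (cong (moves N + moves F +_) total-y) (+-suc (moves N + moves F) (total y′))
  }
  where
  y′ : Vertex _ → ℕ
  y′ x = y x ∸ δ q x
  δ≤y : ∀ x → δ q x ≤ y x
  δ≤y x with q ≟V x
  ... | yes refl = subst₂ _≤_ (sym (δ-refl q)) (sym yq) (s≤s z≤n)
  ... | no q≢x   = subst (_≤ y x) (sym (δ-≢ q x q≢x)) z≤n
  y≡ : ∀ x → y x ≡ δ q x + y′ x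
  y≡ x = sym (m+[n∸m]≡n (δ≤y x))
  total-y : total y ≡ suc (total y′)
  total-y = trans (total-cong y≡) (trans (total-+ (δ q) y′) (cong (_+ total y′) (total-δ q)))

-- Translations of the cube.

infixr 6 _⊕_
_⊕_ : Vertex m → Vertex m → Vertex m
_⊕_ = zipWith _xor_

⊕-involutive : (r x : Vertex m) → r ⊕ (r ⊕ x) ≡ x
⊕-involutive []          []          = refl
⊕-involutive (false ∷ r) (a ∷ x)     = cong (a ∷_) (⊕-involutive r x)
⊕-involutive (true ∷ r)  (false ∷ x) = cong (false ∷_) (⊕-involutive r x)
⊕-involutive (true ∷ r)  (true ∷ x)  = cong (true ∷_) (⊕-involutive r x)

⊕-injective : (r : Vertex m) {x y : Vertex m} → r ⊕ x ≡ r ⊕ y → x ≡ y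
⊕-injective r {x} {y} eq =
  trans (sym (⊕-involutive r x)) (trans (cong (r ⊕_) eq) (⊕-involutive r y))

⊕-origin : (r : Vertex m) → r ⊕ origin ≡ r
⊕-origin []          = refl
⊕-origin (false ∷ r) = cong (false ∷_) (⊕-origin r)
⊕-origin (true ∷ r)  = cong (true ∷_) (⊕-origin r)

hamming-⊕ : (r x y : Vertex m) → hamming (r ⊕ x) (r ⊕ y) ≡ hamming x y
hamming-⊕ []          []          []          = refl
hamming-⊕ (false ∷ r) (a ∷ x)     (b ∷ y)     = cong (_ +_) (hamming-⊕ r x y)
hamming-⊕ (true ∷ r)  (false ∷ x) (false ∷ y) = hamming-⊕ r x y
hamming-⊕ (true ∷ r)  (false ∷ x) (true ∷ y)  = cong suc (hamming-⊕ r x y)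
hamming-⊕ (true ∷ r)  (true ∷ x)  (false ∷ y) = cong suc (hamming-⊕ r x y)
hamming-⊕ (true ∷ r)  (true ∷ x)  (true ∷ y)  = hamming-⊕ r x y

total-⊕ : (r : Vertex m) (f : Vertex m → ℕ) → total (λ x → f (r ⊕ x)) ≡ total f
total-⊕ []          f = refl
total-⊕ (false ∷ r) f = cong₂ _+_ (total-⊕ r (λ x → f (false ∷ x))) (total-⊕ r (λ x → f (true ∷ x)))
total-⊕ (true ∷ r)  f = trans (cong₂ _+_ (total-⊕ r (λ x → f (true ∷ x))) (total-⊕ r (λ x → f (false ∷ x))))
                              (+-comm (total (λ x → f (true ∷ x))) _)

-- Sizes of distributions and the effect of a jump.

𝟙 : Bool → ℕ
𝟙 b = if b then 1 else 0

𝟙≤1 : ∀ b → 𝟙 b ≤ 1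
𝟙≤1 false = z≤n
𝟙≤1 true  = s≤s z≤n

size≡total : (D : Distribution n) → size D ≡ total (λ x → 𝟙 (D x))
size≡total {zero} D with D []
... | true  = refl
... | false = refl
size≡total {suc n} D = begin
  length (filter P? (map (false ∷_) V ++ map (true ∷_) V))
    ≡⟨ cong length (filter-++ P? (map (false ∷_) V) _) ⟩
  length (filter P? (map (false ∷_) V) ++ filter P? (map (true ∷_) V))
    ≡⟨ length-++ (filter P? (map (false ∷_) V)) ⟩
  length (filter P? (map (false ∷_) V)) + length (filter P? (map (true ∷_) V))
    ≡⟨ cong₂ _+_ (half false) (half true) ⟩
  total (λ x → 𝟙 (D x)) ∎
  where
  open ≡-Reasoning
  V = allVertices n
  P? = λ x → D x ≟B true
  half : ∀ b → length (filter P? (map (b ∷_) V)) ≡ total (λ x → 𝟙 (D (b ∷ x)))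
  half b = trans (length-filter-map V) (size≡total (λ x → D (b ∷ x)))
    where
    length-filter-map : ∀ xs → length (filter P? (map (b ∷_) xs)) ≡
                               length (filter (λ x → D (b ∷ x) ≟B true) xs)
    length-filter-map []       = refl
    length-filter-map (x ∷ xs) with D (b ∷ x)
    ... | true  = cong suc (length-filter-map xs)
    ... | false = length-filter-map xs

jump-target : (D : Distribution n) (u v w : Vertex n) → jump D u v w w ≡ true
jump-target D u v w with w ≟V w
... | yes _  = refl
... | no w≢w = ⊥-elim (w≢w refl)

jump-elsewhere : (D : Distribution n) {u v w x : Vertex n} → x ≢ w → x ≢ u → x ≢ v →
                 jump D u v w x ≡ D x
jump-elsewhere D {u} {v} {w} {x} x≢w x≢u x≢v with x ≟V w | x ≟V u | x ≟V v
... | yes x≡w | _       | _       = ⊥-elim (x≢w x≡w)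
... | no _    | yes x≡u | _       = ⊥-elim (x≢u x≡u)
... | no _    | no _    | yes x≡v = ⊥-elim (x≢v x≡v)
... | no _    | no _    | no _    = refl

jump-empty : (D : Distribution n) (u v w x : Vertex n) → x ≢ w → D x ≡ false → jump D u v w x ≡ false
jump-empty D u v w x x≢w Dx with x ≟V w | x ≟V u | x ≟V v
... | yes x≡w | _     | _     = ⊥-elim (x≢w x≡w)
... | no _    | yes _ | _     = refl
... | no _    | no _  | yes _ = refl
... | no _    | no _  | no _  = Dx

-- Carrying out a plan by jumps between cells.

b≢not-b : ∀ b → b ≢ not b
b≢not-b false ()
b≢not-b true  ()

adj-flip : (b : Bool) (x : Vertex m) → Adj (not b ∷ x) (b ∷ x)
adj-flip false x = cong suc (hamming-refl x)
adj-flip true  x = cong suc (hamming-refl x)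

adj-∷ : (b : Bool) {x y : Vertex m} → Adj x y → Adj (b ∷ x) (b ∷ y)
adj-∷ false a = a
adj-∷ true  a = a

-- The cells are translated by r, so that the cell of a target b ∷ r is the origin.
module Cells (r : Vertex m) where

  cell : Distribution (suc m) → Vertex m → ℕ
  cell D p = 𝟙 (D (false ∷ r ⊕ p)) + 𝟙 (D (true ∷ r ⊕ p))

  cell≤2 : ∀ D p → cell D p ≤ 2
  cell≤2 D p = +-mono-≤ (𝟙≤1 (D (false ∷ r ⊕ p))) (𝟙≤1 (D (true ∷ r ⊕ p)))

  cell≡ : ∀ D b p → cell D p ≡ 𝟙 (D (b ∷ r ⊕ p)) + 𝟙 (D (not b ∷ r ⊕ p))
  cell≡ D false p = refl
  cell≡ D true  p = +-comm (𝟙 (D (false ∷ r ⊕ p))) _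

  -- The side `b` of the hole dictates which peg is jumped over: the one on side `b` is adjacent to
  -- the hole.
  fire : Distribution (suc m) → Bool → Vertex m → Vertex m → Distribution (suc m)
  fire D b p q = jump D (not b ∷ r ⊕ p) (b ∷ r ⊕ p) (b ∷ r ⊕ q)

  fire-elsewhere : ∀ D b {p q} x a → x ≢ p → x ≢ q → fire D b p q (a ∷ r ⊕ x) ≡ D (a ∷ r ⊕ x)
  fire-elsewhere D b x a x≢p x≢q = jump-elsewhere D
    (λ e → x≢q (⊕-injective r (∷-injectiveʳ e)))
    (λ e → x≢p (⊕-injective r (∷-injectiveʳ e)))
    (λ e → x≢p (⊕-injective r (∷-injectiveʳ e)))

  -- At `p` the two units on the right outweigh any content of a cell; at `q` the hole is filled
  -- while the other vertex keeps its state.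
  cell-fire : ∀ D b {p q} → p ≢ q → D (b ∷ r ⊕ q) ≡ false → ∀ x →
              cell D x + δ q x ≤ cell (fire D b p q) x + (δ p x + δ p x)
  cell-fire D b {p} {q} p≢q hole x with x ≟V p | x ≟V q
  ... | yes refl | _ = subst₂ _≤_
        (sym (trans (cong (cell D x +_) (δ-≢ q x (≢-sym p≢q))) (+-identityʳ _)))
        (cong (λ k → cell (fire D b x q) x + (k + k)) (sym (δ-refl x)))
        (≤-trans (cell≤2 D x) (m≤n+m 2 _))
  ... | no x≢p | yes refl = subst₂ _≤_
        (sym (cong₂ _+_ (trans (cell≡ D b x) (cong (λ k → 𝟙 k + 𝟙 (D (not b ∷ r ⊕ x))) hole)) (δ-refl x)))
        (cong₂ _+_ (sym (trans (cell≡ (fire D b p x) b x)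
                 (cong₂ (λ k l → 𝟙 k + 𝟙 l) (jump-target D (not b ∷ r ⊕ p) (b ∷ r ⊕ p) (b ∷ r ⊕ x)) other)))
              (cong (λ k → k + k) (sym (δ-≢ p x p≢q))))
        (≤-reflexive (trans (+-comm (𝟙 (D (not b ∷ r ⊕ x))) 1) (sym (+-identityʳ _))))
    where
    other : fire D b p x (not b ∷ r ⊕ x) ≡ D (not b ∷ r ⊕ x)
    other = jump-elsewhere D (λ e → b≢not-b b (sym (∷-injectiveˡ e)))
              (λ e → x≢p (⊕-injective r (∷-injectiveʳ e)))
              (λ e → x≢p (⊕-injective r (∷-injectiveʳ e)))
  ... | no x≢p | no x≢q = ≤-reflexive (cong₂ _+_
        (cong₂ (λ k l → 𝟙 k + 𝟙 l) (sym (fire-elsewhere D b x false x≢p x≢q))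
                                   (sym (fire-elsewhere D b x true x≢p x≢q)))
        (trans (δ-≢ q x (≢-sym x≢q)) (cong (λ k → k + k) (sym (δ-≢ p x (≢-sym x≢p))))))

  -- The origin is exempt because moves of a plan never leave it; that a move into it remains is a
  -- separate hypothesis of `reach-by-plan`.
  Balanced : Distribution (suc m) → Plan m → Set
  Balanced D P = ∀ x → x ≢ origin → out P x + out P x ≤ cell D x + inn P x

  module _ (b₀ : Bool) where

    -- Away from the origin any hole of the target cell will do, but a jump into the origin's cell
    -- must hit the target vertex itself, hence `at-origin`.
    record Fireable (D : Distribution (suc m)) (P : Plan m) : Set where
      field
        target    : Vertex m
        side      : Bool
        hole      : D (side ∷ r ⊕ target) ≡ false
        at-origin : target ≡ origin → side ≡ b₀
        move      : MoveInto P target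
      open MoveInto move public
      field
        full : ∀ a → D (a ∷ r ⊕ from) ≡ true

    weight≢0 : {p : Vertex m} {k : ℕ} → weight p ≡ suc k → p ≢ origin
    weight≢0 w refl with trans (sym (weight-origin m)) w
    ... | ()

    -- A cell that should fire but is not full still expects a pebble, so one looks for a full cell
    -- one step further away from the origin; the cells passed on the way have holes.
    climb : ∀ {D P} → Balanced D P → ∀ k q b → weight q + k ≡ m → D (b ∷ r ⊕ q) ≡ false →
            (q ≡ origin → b ≡ b₀) → 1 ≤ inn P q → Fireable D P
    climb {D} {P} bal k q b wk hole at-o 1≤ with moveInto P q 1≤
    ... | mv = search (D (false ∷ r ⊕ from)) (D (true ∷ r ⊕ from)) refl refl
      where
      open MoveInto mv
      from≢o : from ≢ origin
      from≢o = weight≢0 heavier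
      1≤out : 1 ≤ out P from
      1≤out = subst (1 ≤_) (sym (trans (out≡ from) (cong (_+ out others from) (δ-refl from)))) (s≤s z≤n)
      expects : cell D from ≤ 1 → 1 ≤ inn P from
      expects c≤1 = +-cancelˡ-≤ 1 _ _ (≤-trans (+-mono-≤ 1≤out 1≤out)
                      (≤-trans (bal from from≢o) (+-monoˡ-≤ (inn P from) c≤1)))
      further : ∀ k → weight q + k ≡ m → cell D from ≤ 1 → ∀ b → D (b ∷ r ⊕ from) ≡ false → Fireable D P
      -- Here `q` has the maximal weight `m`, so no heavier neighbour can exist.
      further zero wk _ _ _ = ⊥-elim (1+n≰n (subst₂ _≤_ heavier
        (trans (sym wk) (+-identityʳ (weight q))) (weight≤ from)))
      further (suc k) wk c≤1 b hole = climb {D} {P} bal k from b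
        (trans (cong (_+ k) heavier) (trans (sym (+-suc (weight q) k)) wk))
        hole (λ e → ⊥-elim (from≢o e)) (expects c≤1)
      search : ∀ s t → D (false ∷ r ⊕ from) ≡ s → D (true ∷ r ⊕ from) ≡ t → Fireable D P
      search true true e₀ e₁ = record
        { target = q ; side = b ; hole = hole ; at-origin = at-o ; move = mv
        ; full = λ { false → e₀ ; true → e₁ } }
      search false t e₀ e₁ = further k wk
        (≤-trans (≤-reflexive (cong (λ z → 𝟙 z + 𝟙 (D (true ∷ r ⊕ from))) e₀))
               (𝟙≤1 (D (true ∷ r ⊕ from)))) false e₀
      search true false e₀ e₁ = further k wk
        (≤-trans (≤-reflexive (cong₂ (λ z z′ → 𝟙 z + 𝟙 z′) e₀ e₁)) ≤-refl) true e₁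

    -- Induction on a bound `k` for the number of moves left. Each jump realises one planned move;
    -- unless it enters the origin's cell, which finishes the task, it affects neither the hole at
    -- the target nor the moves planned into the origin.
    reach-by-plan : ∀ k {D P} → moves P ≤ k → D (b₀ ∷ r ⊕ origin) ≡ false → 1 ≤ inn P origin →
                    Balanced D P → Reachable D (b₀ ∷ r ⊕ origin)
    reach-by-plan k {D} {P} ≤k empty 1≤ bal = perform k ≤k (target ≟V origin)
      where
      open Fireable (climb {D} {P} bal m origin b₀ (cong (_+ m) (weight-origin m)) empty (λ _ → refl) 1≤)
      from≢target : from ≢ target
      from≢target e = 1+n≢n (trans (sym heavier) (cong weight e))
      D′ : Distribution (suc m)
      D′ = fire D side from target
      step : Move D D′
      step = peg _ _ _ (full (not side)) (full side) (λ e → b≢not-b side (sym (∷-injectiveˡ e)))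
               (adj-flip side (r ⊕ from)) hole
               (adj-∷ side {r ⊕ from} {r ⊕ target} (trans (hamming-⊕ r from target) adj))
      perform : ∀ k → moves P ≤ k → Dec (target ≡ origin) → Reachable D (b₀ ∷ r ⊕ origin)
      perform k ≤k (yes e) = D′ , step ◅ ε ,
        subst (λ z → D′ z ≡ true) (cong₂ (λ b q → b ∷ r ⊕ q) (at-origin e) e)
              (jump-target D (not side ∷ r ⊕ from) (side ∷ r ⊕ from) (side ∷ r ⊕ target))
      perform zero ≤0 (no _) = ⊥-elim (1+n≢0 (trans (sym fewer) (n≤0⇒n≡0 ≤0)))
      perform (suc k) ≤k (no target≢o)
        with reach-by-plan k {D′} {others}
               (s≤s⁻¹ (subst (_≤ suc k) fewer ≤k))
               (jump-empty D (not side ∷ r ⊕ from) (side ∷ r ⊕ from) (side ∷ r ⊕ target) (b₀ ∷ r ⊕ origin)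
                 (λ e → target≢o (sym (⊕-injective r (∷-injectiveʳ e)))) empty)
               (subst (1 ≤_) (trans (inn≡ origin) (cong (_+ inn others origin) (δ-≢ target origin target≢o))) 1≤)
               bal′
        where
        regroup₁ : ∀ a b → (a + b) + (a + b) ≡ (b + b) + (a + a)
        regroup₁ = solve-∀
        regroup₂ : ∀ a b c → a + (b + b) + c ≡ a + c + (b + b)
        regroup₂ = solve-∀
        -- The pegs lost at `from` are matched by the outgoing move removed there, and the peg
        -- gained at `target` by the incoming one; adding `δ from x` twice on both sides avoids
        -- subtraction.
        bal′ : Balanced D′ others
        bal′ x x≢o = +-cancelʳ-≤ (δ from x + δ from x) _ _ (begin
          out others x + out others x + (δ from x + δ from x)
            ≡⟨ sym (regroup₁ (δ from x) (out others x)) ⟩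
          (δ from x + out others x) + (δ from x + out others x)
            ≡⟨ sym (cong₂ _+_ (out≡ x) (out≡ x)) ⟩
          out P x + out P x                          ≤⟨ bal x x≢o ⟩
          cell D x + inn P x                         ≡⟨ cong (cell D x +_) (inn≡ x) ⟩
          cell D x + (δ target x + inn others x)     ≡⟨ sym (+-assoc (cell D x) _ _) ⟩
          cell D x + δ target x + inn others x
            ≤⟨ +-monoˡ-≤ (inn others x) (cell-fire D side from≢target hole x) ⟩
          cell D′ x + (δ from x + δ from x) + inn others x
            ≡⟨ regroup₂ (cell D′ x) (δ from x) (inn others x) ⟩
          cell D′ x + inn others x + (δ from x + δ from x) ∎)
          where open ≤-Reasoning
      ... | E , D′⟶E , Et = E , step ◅ D′⟶E , Et

-- The upper bound.

full-reach : AllFullReach (suc m) (2 ^ m + 1)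
full-reach {m} D sizeD (b ∷ r) with D (b ∷ r) in Dt
... | true  = D , ε , Dt
... | false = subst (λ z → Reachable D (b ∷ z)) (⊕-origin r)
      (reach-by-plan b (moves P) {D} {P} ≤-refl hole expected (λ x _ →
        ≤-trans (m≤m+n (out P x + out P x) _)
        (≤-trans (bal x) (+-monoˡ-≤ (inn P x) (m∸n≤m (cell D x) (δ origin x))))))
  where
  open Cells r
  hole : D (b ∷ r ⊕ origin) ≡ false
  hole = trans (cong (λ z → D (b ∷ z)) (⊕-origin r)) Dt
  -- Setting aside one peg of the origin's cell makes that cell, which has a hole, count as empty.
  -- Hence the pebble supplied there can only arrive by a move, which is `expected`.
  spare : Vertex m → ℕ
  spare x = cell D x ∸ δ origin x
  total-cell : total (cell D) ≡ 2 ^ m + 1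
  total-cell = begin
    total (cell D)         ≡⟨ total-+ (λ x → 𝟙 (D (false ∷ r ⊕ x))) (λ x → 𝟙 (D (true ∷ r ⊕ x))) ⟩
    total (λ x → 𝟙 (D (false ∷ r ⊕ x))) + total (λ x → 𝟙 (D (true ∷ r ⊕ x)))
                           ≡⟨ cong₂ _+_ (total-⊕ r (λ x → 𝟙 (D (false ∷ x))))
                                        (total-⊕ r (λ x → 𝟙 (D (true ∷ x)))) ⟩
    total (λ x → 𝟙 (D x))  ≡⟨ sym (size≡total D) ⟩
    size D                 ≡⟨ sizeD ⟩
    2 ^ m + 1              ∎
    where open ≡-Reasoning
  enough : 2 ^ m ≤ total spare
  enough = +-cancelˡ-≤ 1 _ _ (begin
    1 + 2 ^ m                          ≡⟨ +-comm 1 (2 ^ m) ⟩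
    2 ^ m + 1                          ≡⟨ sym total-cell ⟩
    total (cell D)                     ≤⟨ total-mono (λ x → m≤n+m∸n (cell D x) (δ origin x)) ⟩
    total (λ x → δ origin x + spare x) ≡⟨ total-+ (δ origin) spare ⟩
    total (δ {m} origin) + total spare ≡⟨ cong (_+ total spare) (total-δ {m} origin) ⟩
    1 + total spare                    ∎)
    where open ≤-Reasoning
  plan : Supplies 1 spare
  plan = supplies-1 m spare enough
  P : Plan m
  P = proj₁ plan
  bal : ∀ x → out P x + out P x + 1 * δ origin x ≤ spare x + inn P x
  bal = proj₂ plan
  spare-origin : spare origin ≡ 0
  spare-origin = trans (cong (cell D origin ∸_) (δ-refl (origin {m})))
    (m≤n⇒m∸n≡0 (≤-trans (≤-reflexive (trans (cell≡ D b origin)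
      (cong (λ k → 𝟙 k + 𝟙 (D (not b ∷ r ⊕ origin))) hole))) (𝟙≤1 (D (not b ∷ r ⊕ origin)))))
  expected : 1 ≤ inn P origin
  expected = begin
    1                           ≡⟨ sym (δ-refl (origin {m})) ⟩
    δ {m} origin origin         ≡⟨ sym (*-identityˡ (δ {m} origin origin)) ⟩
    1 * δ {m} origin origin     ≤⟨ m≤n+m _ (out P origin + out P origin) ⟩
    out P origin + out P origin + 1 * δ {m} origin origin ≤⟨ bal origin ⟩
    spare origin + inn P origin ≡⟨ cong (_+ inn P origin) spare-origin ⟩
    inn P origin                ∎
    where open ≤-Reasoning

-- Parity and the lower bound.

parity : Vertex n → Bool
parity []      = false
parity (b ∷ x) = b xor parity x

parity-origin : ∀ n → parity (origin {n}) ≡ false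
parity-origin zero    = refl
parity-origin (suc n) = parity-origin n

hamming≡0⇒≡ : (x y : Vertex n) → hamming x y ≡ 0 → x ≡ y
hamming≡0⇒≡ []          []          _  = refl
hamming≡0⇒≡ (false ∷ x) (false ∷ y) eq = cong (false ∷_) (hamming≡0⇒≡ x y eq)
hamming≡0⇒≡ (true ∷ x)  (true ∷ y)  eq = cong (true ∷_) (hamming≡0⇒≡ x y eq)

parity-adj : (x y : Vertex n) → Adj x y → parity x ≡ not (parity y)
parity-adj []          []          ()
parity-adj (false ∷ x) (false ∷ y) a = parity-adj x y a
parity-adj (true ∷ x)  (true ∷ y)  a = cong not (parity-adj x y a)
parity-adj (false ∷ x) (true ∷ y)  a
  rewrite hamming≡0⇒≡ x y (suc-injective a) = sym (not-involutive (parity y))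
parity-adj (true ∷ x)  (false ∷ y) a
  rewrite hamming≡0⇒≡ x y (suc-injective a) = refl

even : Vertex n → ℕ
even x = 𝟙 (not (parity x))

-- Every edge in the first direction has exactly one even end.
total-even : ∀ m → total (even {suc m}) ≡ 2 ^ m
total-even m = begin
  total (even {suc m})                                ≡⟨ sym (total-+ {m} (λ x → even (false ∷ x)) (λ x → even (true ∷ x))) ⟩
  total {m} (λ x → even (false ∷ x) + even (true ∷ x)) ≡⟨ total-cong {m} (λ x → one (parity x)) ⟩
  total {m} (λ _ → 1)                                 ≡⟨ total-const m 1 ⟩
  2 ^ m * 1                                           ≡⟨ *-identityʳ (2 ^ m) ⟩
  2 ^ m                                               ∎
  where
  open ≡-Reasoning
  one : ∀ b → 𝟙 (not b) + 𝟙 (not (not b)) ≡ 1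
  one false = refl
  one true  = refl

-- With pegs on even vertices only, no two pegs are adjacent, so the odd vertex `true ∷ origin`
-- stays empty.
not-full-reach : ∀ d → d ≤ 2 ^ m → ¬ AllFullReach (suc m) d
not-full-reach {m} d d≤ all = stuck (all D sizeD (true ∷ origin))
  where
  selection : ∃ λ y → (∀ x → y x ≤ even x) × total {suc m} y ≡ d
  selection = total-split even d (subst (d ≤_) (sym (total-even m)) d≤)
  y : Vertex (suc m) → ℕ
  y = proj₁ selection
  y≤even : ∀ x → y x ≤ even x
  y≤even = proj₁ (proj₂ selection)
  D : Distribution (suc m)
  -- Bounded by the 0-1 function `even`, `y` is itself an indicator.
  D x = does (y x ≟ 1)
  𝟙D : ∀ x → 𝟙 (D x) ≡ y x
  𝟙D x with y x | ≤-trans (y≤even x) (𝟙≤1 (not (parity x)))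
  ... | 0 | _       = refl
  ... | 1 | _       = refl
  ... | suc (suc _) | s≤s ()
  sizeD : size D ≡ d
  sizeD = trans (size≡total D) (trans (total-cong 𝟙D) (proj₂ (proj₂ selection)))
  D-even : ∀ x → D x ≡ true → parity x ≡ false
  D-even x Dx with parity x | ≤-trans (≤-reflexive (trans (cong 𝟙 (sym Dx)) (𝟙D x))) (y≤even x)
  -- For odd `x` the second component would prove `1 ≤ 0`.
  ... | false | _ = refl
  stuck : ¬ Reachable D (true ∷ origin)
  stuck (_ , ε , Dt) with trans (sym (D-even _ Dt)) (cong not (parity-origin m))
  ... | ()
  stuck (_ , peg u v w Du Dv _ uv _ _ ◅ _ , _)
    with trans (sym (D-even u Du)) (trans (parity-adj u v uv) (cong not (D-even v Dv)))
  ... | ()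

theorem5p1 : (n : ℕ) → 1 ≤ n → IsPeggingNumber n (2 ^ (n ∸ 1) + 1)
theorem5p1 (suc m) _ =
    m≤n+m 1 (2 ^ m)
  , full-reach
  , λ d _ d< → not-full-reach d (s≤s⁻¹ (subst (suc d ≤_) (+-comm (2 ^ m) 1) d<))
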